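{- Let $n\ge2$, $1\le p\le n-1$, $r\in[n]$, and let $\pi\in S_n$ be a $p$-resultant permutation. Then there exists $\sigma\in S_{n-1}$ such that the configuration $\sigma^{(r,p)}$ topples to $\pi$ if and only if: (1) if $r\le n-p$, then $r$ is a left-to-right maximum of $\pi^{\mathrm{left}}$; and (2) if $r>n-p$, then $r$ is a right-to-left minimum of $\pi^{\mathrm{right}}$.
   Context: Sites $\{0,1,\dots,n\}$. For $\sigma\in S_{n-1}$, $r\in[n]$, the configuration $\sigma^{(r,p)}$ places on site $i$ ($1\le i\le n-1$) the chip $\sigma_i$ if $\sigma_i<r$ and $\sigma_i+1$ otherwise, plus an extra chip $r$ on site $p$. More generally $\mathcal{S}(n-1,p)$ denotes all configurations of chips $1,\dots,n$ with one chip on each of sites $1,\dots,n-1$ and an extra one on site $p$. Toppling: while a site $i$ has at least two chips, pick two chips $\alpha<\beta$ there and move $\alpha$ to $i-1$, $\beta$ to $i+1$; the final configuration is independent of choices, has one chip per site except one, and reading left to right gives the permutation the configuration topples to. $\pi\in S_n$ is $p$-resultant if some configuration in $\mathcal{S}(n-1,p)$ topples to it; then $(\pi_1,\dots,\pi_{n-p})$ is a permutation of $[n-p]$. $\pi^{\mathrm{left}}=(\pi_1,\dots,\pi_{n-p})$, $\pi^{\mathrm{right}}=(\pi_{n-p+1},\dots,\pi_n)$. A left-to-right maximum of $w$ is $w_j$ with $w_j=\max(w_1,\dots,w_j)$; a right-to-left minimum is an entry smaller than all entries to its right (last entry included). -}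

module Defs where

open import Data.Nat using (ℕ; zero; suc; _+_; _∸_; _≤_; _<_; _≟_; _<?_)
open import Data.Integer as ℤ using (ℤ; +_)
open import Data.Fin as Fin using (Fin)
open import Data.List using (List; []; _∷_; map; upTo; zip; length; lookup)
open import Data.Product using (Σ; ∃; _×_; _,_)
open import Relation.Nullary using (¬_; yes; no)
open import Relation.Binary.PropositionalEquality using (_≡_)
open import Relation.Binary.Construct.Closure.ReflexiveTransitive using (Star)
open import Data.List.Relation.Binary.Permutation.Propositional using (_↭_)

range1 : ℕ → List ℕ
range1 m = map suc (upTo m)

-- A configuration: chips are labelled by natural numbers (only labels 1..n
-- are meaningful); a configuration gives the site (an integer) of each chip.
Config : Set
Config = ℕ → ℤ

-- Configuration given by an explicit list of (chip , site) pairs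
-- (first matching pair wins; unlisted chips are sent to site 0 – irrelevant).
configOf : List (ℕ × ℕ) → Config
configOf [] x = + 0
configOf ((c , s) ∷ ps) x with x ≟ c
... | yes _ = + s
... | no  _ = configOf ps x

placement : ℕ → List ℕ → ℕ → Config
placement x rest p = configOf ((x , p) ∷ zip rest (range1 (length rest)))

relabel : ℕ → ℕ → ℕ
relabel r s with s <? r
... | yes _ = s
... | no  _ = suc s

sigmaConfig : List ℕ → ℕ → ℕ → Config
sigmaConfig σ r p = placement r (map (relabel r) σ) p

record Step (n : ℕ) (c c' : Config) : Set where
  field
    α β : ℕ
    i   : ℤ
    1≤α : 1 ≤ α
    α<β : α < β
    β≤n : β ≤ n
    cα  : c α ≡ i
    cβ  : c β ≡ i
    c'α : c' α ≡ i ℤ.- ℤ.+ 1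
    c'β : c' β ≡ i ℤ.+ ℤ.+ 1
    rest : ∀ x → ¬ x ≡ α → ¬ x ≡ β → c' x ≡ c x

Stable : ℕ → Config → Set
Stable n c = ∀ a b → 1 ≤ a → a ≤ n → 1 ≤ b → b ≤ n → ¬ a ≡ b → ¬ c a ≡ c b

ReadsAs : Config → List ℕ → Set
ReadsAs c π = ∀ (j k : Fin (length π)) → j Fin.< k → c (lookup π j) ℤ.< c (lookup π k)

TopplesTo : ℕ → Config → List ℕ → Set
TopplesTo n c π = ∃ λ c' → Star (Step n) c c' × Stable n c' × ReadsAs c' π

InS : ℕ → ℕ → Config → Set
InS n p c = Σ ℕ λ x → Σ (List ℕ) λ rest →
  ((x ∷ rest) ↭ range1 n) × (∀ y → c y ≡ placement x rest p y)

Resultant : ℕ → ℕ → List ℕ → Set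
Resultant n p π = ∃ λ c → InS n p c × TopplesTo n c π

LRMax : ℕ → List ℕ → Set
LRMax r w = ∃ λ (j : Fin (length w)) →
  lookup w j ≡ r × (∀ (i : Fin (length w)) → i Fin.< j → lookup w i ≤ r)

RLMin : ℕ → List ℕ → Set
RLMin r w = ∃ λ (j : Fin (length w)) →
  lookup w j ≡ r × (∀ (k : Fin (length w)) → j Fin.< k → r < lookup w k)

{-# OPTIONS --safe #-}

-- A configuration reached from one with a single doubled site is encoded by a
-- lattice path: a word with p letters "row" and n ∸ p letters "col", each carrying
-- a chip.  The k-th letter (from 0) sits at site k + 1 if it is a row and at site
-- k if it is a col, so two chips share a site exactly when a row is immediately
-- followed by a col, and toppling turns row a, col b into col (min a b),
-- row (max a b).  All rows come first in the initial word, all cols in the final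
-- one, which therefore reads π-left, π-right.
--
-- Along topplings every col has a smaller chip than every later row.  Moreover,
-- while r is on a col all earlier cols are smaller, and while it is on a row all
-- later rows are larger; this holds initially because the extra chip r may be put
-- on the first col.  Conversely a word whose cols are all smaller than its rows is
-- sorted without ever exchanging chips.  To get a prescribed result with r on the
-- first col, start from this word.  If r is a left-to-right maximum and the first
-- col carries s ≠ r, rotate r, s and the chip z of the last row: s goes to the last
-- row, r to the first col and z to the col where r has to end.  If r is a
-- right-to-left minimum, swap it with the chip of the first col.
module Submission where

open import Defs
open import Data.Nat using (ℕ; zero; suc; _+_; _∸_; _≤_; _<_; z≤n; s≤s; s≤s⁻¹; _≟_; _<?_; _≤?_)
open import Data.Nat.Properties using
  (≤-refl; ≤-reflexive; ≤-trans; <⇒≤; <⇒≱; <⇒≢; ≤⇒≯; ≰⇒>; ≤∧≢⇒<; n<1+n; n≮n; n≤1+n;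
   +-suc; +-comm; +-identityʳ; +-cancelˡ-≡; +-∸-assoc; m∸n+n≡m; m≤n⇒m⊓n≡m; m≤n⇒m≤1+n;
   m<n⇒0<n∸m; suc-injective)
open import Data.Integer as ℤ using (+_)
open import Data.Integer.Properties as ℤ using (+-injective)
open import Data.Fin as Fin using (zero; suc)
open import Data.List using
  (List; []; _∷_; [_]; _∷ʳ_; _++_; map; upTo; applyUpTo; zip; length; lookup; take; drop;
   initLast; _∷ʳ′_)
open import Data.List.Properties using
  (∷-injective; length-map; length-++; length-take; length-drop; length-upTo; map-++; map-upTo;
   upTo-∷ʳ; map-id-local; ++-assoc; ++-identityʳ; take++drop≡id; tabulate-lookup)
open import Data.List.Membership.Propositional using (_∈_; _∉_)
open import Data.List.Membership.Propositional.Properties using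
  (∈-++⁺ˡ; ∈-++⁺ʳ; ∈-++⁻; ∈-map⁺; ∈-map⁻; ∈-upTo⁺; ∈-upTo⁻; ∈-∃++; ∈-lookup)
open import Data.List.Relation.Unary.Any using (here; there)
open import Data.List.Relation.Unary.All as All using (All; []; _∷_)
import Data.List.Relation.Unary.All.Properties as All
open import Data.List.Relation.Unary.AllPairs as AllPairs using (AllPairs; []; _∷_)
import Data.List.Relation.Unary.AllPairs.Properties as AllPairs
open import Data.List.Relation.Unary.Unique.Propositional using (Unique)
open import Data.List.Relation.Unary.Unique.Propositional.Properties as Unique using
  (Unique[x∷xs]⇒x∉xs)
open import Data.List.Relation.Binary.Subset.Propositional using (_⊆_)
open import Data.List.Relation.Binary.Permutation.Propositional using
  (_↭_; ↭-refl; ↭-sym; ↭-trans; ↭-reflexive; ↭⇒↭ₛ; prep; swap)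
open import Data.List.Relation.Binary.Permutation.Propositional.Properties using
  (∈-resp-↭; ↭-length; ↭-map-inv; shift; drop-∷; ∷↭∷ʳ; ++⁺ʳ; map⁺)
import Data.List.Relation.Binary.Permutation.Setoid.Properties as PermutationSetoid
open import Data.Product using (∃; ∃₂; _×_; _,_; proj₁; proj₂)
open import Data.Sum using (_⊎_; inj₁; inj₂)
open import Data.Unit using (⊤; tt)
open import Function using (_∘_)
open import Function.Bundles using (_⇔_; mk⇔)
open import Relation.Binary.Construct.Closure.ReflexiveTransitive using (Star; ε; _◅_; _◅◅_; gmap)
open import Relation.Binary.PropositionalEquality using
  (_≡_; _≢_; refl; sym; trans; cong; cong₂; subst; subst₂; setoid; module ≡-Reasoning)
open import Relation.Nullary using (¬_; yes; no; contradiction)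

-- Lists: sortedness, pigeonhole, splitting.

private
  variable
    A : Set
    R : A → A → Set
    a b : A
    xs ys : List A

AllPairs-++⁻ : ∀ (xs : List A) {ys} → AllPairs R (xs ++ ys) →
               AllPairs R xs × AllPairs R ys × All (λ x → All (R x) ys) xs
AllPairs-++⁻ []       ps       = [] , ps , []
AllPairs-++⁻ (x ∷ xs) (p ∷ ps) with AllPairs-++⁻ xs ps
... | pxs , pys , pxsys = All.++⁻ˡ xs p ∷ pxs , pys , All.++⁻ʳ xs p ∷ pxsys

AllPairs-lookup : AllPairs R xs → ∀ {i j} → i Fin.< j → R (lookup xs i) (lookup xs j)
AllPairs-lookup (p ∷ _)  {zero}  {suc j} _         = All.lookup p (∈-lookup j)
AllPairs-lookup (_ ∷ ps) {suc i} {suc j} (s≤s i<j) = AllPairs-lookup ps i<j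

AllPairs-compare : AllPairs R xs → a ∈ xs → b ∈ xs → a ≢ b → R a b ⊎ R b a
AllPairs-compare _        (here refl) (here refl) a≢b = contradiction refl a≢b
AllPairs-compare (p ∷ _)  (here refl) (there b∈)  _   = inj₁ (All.lookup p b∈)
AllPairs-compare (p ∷ _)  (there a∈)  (here refl) _   = inj₂ (All.lookup p a∈)
AllPairs-compare (_ ∷ ps) (there a∈)  (there b∈)  a≢b = AllPairs-compare ps a∈ b∈ a≢b

-- If the heads differed, each would lie in the tail of the other list, so they would be related
-- both ways. Sorting by final site thus determines what a configuration reads as.
sorted-↭⇒≡ : (∀ {a b} → R a b → ¬ R b a) →
             AllPairs R xs → AllPairs R ys → xs ↭ ys → xs ≡ ys
sorted-↭⇒≡ _ [] [] _ = refl
sorted-↭⇒≡ _ [] (_ ∷ _) p with () ← ↭-length p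
sorted-↭⇒≡ _ (_ ∷ _) [] p with () ← ↭-length p
sorted-↭⇒≡ {xs = x ∷ _} asym (px ∷ pxs) (py ∷ pys) p
  with ∈-resp-↭ p (here refl) | ∈-resp-↭ (↭-sym p) (here refl)
... | here refl | _         = cong (x ∷_) (sorted-↭⇒≡ asym pxs pys (drop-∷ p))
... | there _   | here refl = cong (x ∷_) (sorted-↭⇒≡ asym pxs pys (drop-∷ p))
... | there x∈  | there y∈  = contradiction (All.lookup px y∈) (asym (All.lookup py x∈))

Unique-resp-↭ : {xs ys : List ℕ} → xs ↭ ys → Unique xs → Unique ys
Unique-resp-↭ p = PermutationSetoid.Unique-resp-↭ (setoid ℕ) (↭⇒↭ₛ p)

-- Pigeonhole, by deleting the head of `xs` from both lists; the tail stays included because that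
-- head does not recur in it.
Unique-⊆⇒length≤ : Unique xs → xs ⊆ ys → length xs ≤ length ys
Unique-⊆⇒length≤ []       _  = z≤n
Unique-⊆⇒length≤ {xs = x ∷ xs} (x∉ ∷ xs!) xs⊆ys with ∈-∃++ (xs⊆ys (here refl))
... | us , vs , refl =
  ≤-trans (s≤s (Unique-⊆⇒length≤ xs! xs⊆)) (≤-reflexive (sym (↭-length (shift x us vs))))
  where
  xs⊆ : xs ⊆ us ++ vs
  xs⊆ y∈ with ∈-resp-↭ (shift x us vs) (xs⊆ys (there y∈))
  ... | here refl = contradiction refl (All.lookup x∉ y∈)
  ... | there y∈′ = y∈′

take-++ : ∀ (xs : List A) {ys} → take (length xs) (xs ++ ys) ≡ xs
take-++ []       = refl
take-++ (x ∷ xs) = cong (x ∷_) (take-++ xs)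

drop-++ : ∀ (xs : List A) {ys} → drop (length xs) (xs ++ ys) ≡ ys
drop-++ []       = refl
drop-++ (x ∷ xs) = drop-++ xs

++-injective : ∀ {us xs : List A} {vs ys} → us ++ vs ≡ xs ++ ys → length us ≡ length xs →
               us ≡ xs × vs ≡ ys
++-injective {us = []}     {[]}     eq _   = refl , eq
++-injective {us = u ∷ us} {x ∷ xs} eq len
  with refl , eq′ ← ∷-injective eq
  with refl , refl ← ++-injective {us = us} {xs} eq′ (suc-injective len) = refl , refl

length-≡⇒++-length : ∀ (xs : List A) {ys m n} → length (xs ++ ys) ≡ n → m ≤ n →
                     length xs ≡ n ∸ m → length ys ≡ m
length-≡⇒++-length xs {ys} {m} {n} eq m≤n eqˡ = +-cancelˡ-≡ (n ∸ m) _ _ (begin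
  n ∸ m + length ys     ≡⟨ cong (_+ length ys) (sym eqˡ) ⟩
  length xs + length ys ≡⟨ sym (length-++ xs) ⟩
  length (xs ++ ys)     ≡⟨ eq ⟩
  n                     ≡⟨ sym (m∸n+n≡m m≤n) ⟩
  n ∸ m + m             ∎)
  where open ≡-Reasoning

-- Records of a word

LRMax⁺ : ∀ us {vs r} → All (_≤ r) us → LRMax r (us ++ r ∷ vs)
LRMax⁺ []       _  = zero , refl , λ _ ()
LRMax⁺ (u ∷ us) (u≤r ∷ us≤r) with LRMax⁺ us us≤r
... | j , eq , max = suc j , eq , λ { zero _ → u≤r ; (suc i) (s≤s i<j) → max i i<j }

-- The index of the record becomes a split of the word at `r`, the form in which the toppling
-- sequences are later written.
LRMax⁻ : ∀ w {r} → LRMax r w → ∃₂ λ us vs → w ≡ us ++ r ∷ vs × All (_≤ r) us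
LRMax⁻ (x ∷ w) (zero  , refl , _)   = [] , w , refl , []
LRMax⁻ (x ∷ w) (suc j , eq   , max)
  with LRMax⁻ w (j , eq , λ i i<j → max (suc i) (s≤s i<j))
... | us , vs , refl , us≤r = x ∷ us , vs , refl , max zero (s≤s z≤n) ∷ us≤r

RLMin⁺ : ∀ us {vs r} → All (r <_) vs → RLMin r (us ++ r ∷ vs)
RLMin⁺ []       r<vs = zero , refl , λ { (suc k) _ → All.lookup r<vs (∈-lookup k) }
RLMin⁺ (u ∷ us) r<vs with RLMin⁺ us r<vs
... | j , eq , min = suc j , eq , λ { (suc k) (s≤s j<k) → min k j<k }

RLMin⁻ : ∀ w {r} → RLMin r w → ∃₂ λ us vs → w ≡ us ++ r ∷ vs × All (r <_) vs
RLMin⁻ (x ∷ w) (zero  , refl , min) = [] , w , refl ,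
  subst (All _) (tabulate-lookup w) (All.tabulate⁺ λ k → min (suc k) (s≤s z≤n))
RLMin⁻ (x ∷ w) (suc j , eq   , min)
  with RLMin⁻ w (j , eq , λ k j<k → min (suc k) (s≤s j<k))
... | us , vs , refl , r<vs = x ∷ us , vs , refl , r<vs

-- Chips 1, …, n

∈-range1⁺ : ∀ {n x} → 1 ≤ x → x ≤ n → x ∈ range1 n
∈-range1⁺ {x = suc x} _ x<n = ∈-map⁺ suc (∈-upTo⁺ x<n)

∈-range1⁻ : ∀ {n x} → x ∈ range1 n → 1 ≤ x × x ≤ n
∈-range1⁻ x∈ with ∈-map⁻ suc x∈
... | _ , x′∈ , refl = s≤s z≤n , ∈-upTo⁻ x′∈

range1-Unique : ∀ n → Unique (range1 n)
range1-Unique n = Unique.map⁺ suc-injective (Unique.upTo⁺ n)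

↭-range1⇒Unique : ∀ n {xs} → xs ↭ range1 n → Unique xs
↭-range1⇒Unique n range = Unique-resp-↭ (↭-sym range) (range1-Unique n)

length-range1 : ∀ n → length (range1 n) ≡ n
length-range1 n = trans (length-map suc (upTo n)) (length-upTo n)

range1-∷ʳ : ∀ n → range1 (suc n) ≡ range1 n ∷ʳ suc n
range1-∷ʳ n = trans (cong (map suc) (sym (upTo-∷ʳ n))) (map-++ suc (upTo n) [ n ])

relabel-< : ∀ {r s} → s < r → relabel r s ≡ s
relabel-< {r} {s} s<r with s <? r
... | yes _  = refl
... | no s≮r = contradiction s<r s≮r

relabel-≥ : ∀ {r s} → r ≤ s → relabel r s ≡ suc s
relabel-≥ {r} {s} r≤s with s <? r
... | yes s<r = contradiction s<r (≤⇒≯ r≤s)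
... | no _    = refl

-- Induction on `m`. If `r` is `suc m`, nothing is relabelled and `r` only moves to the end.
-- Otherwise the largest label is at least `r`, is raised by one, and the others are handled by
-- induction.
relabel-range1 : ∀ m {r} → 1 ≤ r → r ≤ suc m → r ∷ map (relabel r) (range1 m) ↭ range1 (suc m)
relabel-range1 m {r} 1≤r r≤1+m with r ≟ suc m
... | yes refl = ↭-trans
  (↭-reflexive (cong (r ∷_) (map-id-local (All.tabulate (relabel-< ∘ s≤s ∘ proj₂ ∘ ∈-range1⁻ {m})))))
  (↭-trans (∷↭∷ʳ r (range1 m)) (↭-reflexive (sym (range1-∷ʳ m))))
relabel-range1 zero    {r} 1≤r r≤1 | no r≢1 = contradiction (≤∧≢⇒< r≤1 r≢1) (≤⇒≯ 1≤r)
relabel-range1 (suc m) {r} 1≤r r≤2+m | no r≢2+m = ↭-trans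
  (↭-reflexive (cong (r ∷_) (trans (cong (map (relabel r)) (range1-∷ʳ m))
    (trans (map-++ (relabel r) (range1 m) [ suc m ])
      (cong (map (relabel r) (range1 m) ∷ʳ_) (relabel-≥ r≤1+m))))))
  (↭-trans (++⁺ʳ [ suc (suc m) ] (relabel-range1 m 1≤r r≤1+m))
    (↭-reflexive (sym (range1-∷ʳ (suc m)))))
  where
  r≤1+m : r ≤ suc m
  r≤1+m = s≤s⁻¹ (≤∧≢⇒< r≤2+m r≢2+m)

module _ {n} {cs xs : List ℕ} (range : cs ++ xs ↭ range1 n) (cs<xs : All (λ c → All (c <_) xs) cs) where

  private
    chips! : Unique (cs ++ xs)
    chips! = ↭-range1⇒Unique n range

  -- All of `xs` exceeds `r`, so the chips 1 to `r` lie in `cs`; count them. Together with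
  -- `∈-high⇒>` this tells from the size of `r` on which side it lies.
  ∈-low⇒≤ : ∀ {r} → r ∈ cs → r ≤ length cs
  ∈-low⇒≤ {r} r∈cs = subst (_≤ length cs) (length-range1 r)
    (Unique-⊆⇒length≤ (range1-Unique r) below)
    where
    below : range1 r ⊆ cs
    below x∈ with ∈-range1⁻ {r} x∈
    ... | 1≤x , x≤r
      with ∈-++⁻ cs (∈-resp-↭ (↭-sym range) (∈-range1⁺ 1≤x
             (≤-trans x≤r (proj₂ (∈-range1⁻ {n} (∈-resp-↭ range (∈-++⁺ˡ r∈cs)))))))
    ...   | inj₁ x∈cs = x∈cs
    ...   | inj₂ x∈xs = contradiction (All.lookup (All.lookup cs<xs r∈cs) x∈xs) (≤⇒≯ x≤r)

  -- Here `r` and the members of `cs` are distinct labels among 1 to `r`.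
  ∈-high⇒> : ∀ {r} → r ∈ xs → length cs < r
  ∈-high⇒> {r} r∈xs = subst (suc (length cs) ≤_) (length-range1 r)
    (Unique-⊆⇒length≤ (All.map (λ c<xs → <⇒≢ (All.lookup c<xs r∈xs) ∘ sym) cs<xs
                        ∷ proj₁ (AllPairs-++⁻ cs chips!)) below)
    where
    below : r ∷ cs ⊆ range1 r
    below (here refl) = ∈-range1⁺ (proj₁ (∈-range1⁻ {n} (∈-resp-↭ range (∈-++⁺ʳ cs r∈xs)))) ≤-refl
    below (there x∈)  = ∈-range1⁺ (proj₁ (∈-range1⁻ {n} (∈-resp-↭ range (∈-++⁺ˡ x∈))))
      (<⇒≤ (All.lookup (All.lookup cs<xs x∈) r∈xs))

-- Toppling words

data Letter : Set where
  row col : ℕ → Letter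

Word : Set
Word = List Letter

chip : Letter → ℕ
chip (row a) = a
chip (col a) = a

chips : Word → List ℕ
chips = map chip

-- An invariant of toppling; comparing the initial with the final word, it shows that the low part
-- has length `n ∸ p`.
columns : Word → ℕ
columns []          = 0
columns (row _ ∷ w) = columns w
columns (col _ ∷ w) = suc (columns w)

infix 4 _⟶_ _⟶*_

-- One toppling move, split by which letter holds the smaller chip: `pass` leaves each chip on its
-- kind of letter, `exchange` leaves the chips in place in the word and swaps the kinds.
data _⟶_ : Word → Word → Set where
  pass     : ∀ {a b v} → b < a → row a ∷ col b ∷ v ⟶ col b ∷ row a ∷ v
  exchange : ∀ {a b v} → a < b → row a ∷ col b ∷ v ⟶ col a ∷ row b ∷ v
  _∷_      : ∀ l {w w′} → w ⟶ w′ → l ∷ w ⟶ l ∷ w′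

_⟶*_ : Word → Word → Set
_⟶*_ = Star _⟶_

chips-map : ∀ {f : ℕ → Letter} → (∀ x → chip (f x) ≡ x) → ∀ xs → chips (map f xs) ≡ xs
chips-map eq []       = refl
chips-map eq (x ∷ xs) = cong₂ _∷_ (eq x) (chips-map eq xs)

chips-rows : ∀ xs → chips (map row xs) ≡ xs
chips-rows = chips-map (λ _ → refl)

chips-cols : ∀ xs → chips (map col xs) ≡ xs
chips-cols = chips-map (λ _ → refl)

chips-rows-cols : ∀ xs ys → chips (map row xs ++ map col ys) ≡ xs ++ ys
chips-rows-cols xs ys = trans (map-++ chip (map row xs) _) (cong₂ _++_ (chips-rows xs) (chips-cols ys))

chips-cols-rows : ∀ xs ys → chips (map col xs ++ map row ys) ≡ xs ++ ys
chips-cols-rows xs ys = trans (map-++ chip (map col xs) _) (cong₂ _++_ (chips-cols xs) (chips-rows ys))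

columns-rows-cols : ∀ xs ys → columns (map row xs ++ map col ys) ≡ length ys
columns-rows-cols (x ∷ xs) ys       = columns-rows-cols xs ys
columns-rows-cols []       []       = refl
columns-rows-cols []       (y ∷ ys) = cong suc (columns-rows-cols [] ys)

columns-cols-rows : ∀ xs ys → columns (map col xs ++ map row ys) ≡ length xs
columns-cols-rows (x ∷ xs) ys       = cong suc (columns-cols-rows xs ys)
columns-cols-rows []       []       = refl
columns-cols-rows []       (y ∷ ys) = columns-cols-rows [] ys

⟶-chips : ∀ {w w′} → w ⟶ w′ → chips w ↭ chips w′
⟶-chips (pass _)     = swap _ _ ↭-refl
⟶-chips (exchange _) = ↭-refl
⟶-chips (l ∷ s)      = prep _ (⟶-chips s)

⟶*-chips : ∀ {w w′} → w ⟶* w′ → chips w ↭ chips w′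
⟶*-chips ε        = ↭-refl
⟶*-chips (s ◅ ss) = ↭-trans (⟶-chips s) (⟶*-chips ss)

⟶-columns : ∀ {w w′} → w ⟶ w′ → columns w ≡ columns w′
⟶-columns (pass _)      = refl
⟶-columns (exchange _)  = refl
⟶-columns (row _ ∷ s)   = ⟶-columns s
⟶-columns (col _ ∷ s)   = cong suc (⟶-columns s)

⟶*-columns : ∀ {w w′} → w ⟶* w′ → columns w ≡ columns w′
⟶*-columns ε        = refl
⟶*-columns (s ◅ ss) = trans (⟶-columns s) (⟶*-columns ss)

module _ (r : ℕ) where

  -- The first letter stands anywhere before the second. A row before a col has still to cross it,
  -- so nothing is asked there. The inequalities are weak; distinctness of chips supplies `<` at the
  -- end.
  Ordered : Letter → Letter → Set
  Ordered (col a) (row b) = a ≤ b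
  Ordered (col a) (col b) = b ≡ r → a ≤ r
  Ordered (row a) (row b) = a ≡ r → r ≤ b
  Ordered (row a) (col b) = ⊤

  private
    -- Here `l` stands before the toppled pair. If `exchange` puts `r` on a col, an earlier col is
    -- below it because it was already below the row that carried `r`.
    ⟶-All-Ordered : ∀ l {w w′} → w ⟶ w′ → All (Ordered l) w → All (Ordered l) w′
    ⟶-All-Ordered l       (pass _)       (p ∷ q ∷ ps) = q ∷ p ∷ ps
    ⟶-All-Ordered (row c) (exchange a<b) (p ∷ _ ∷ ps) =
      tt ∷ (λ { refl → ≤-trans (p refl) (<⇒≤ a<b) }) ∷ ps
    ⟶-All-Ordered (col c) (exchange a<b) (p ∷ _ ∷ ps) =
      (λ { refl → p }) ∷ ≤-trans p (<⇒≤ a<b) ∷ ps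
    ⟶-All-Ordered l       (_ ∷ s)        (p ∷ ps)     = p ∷ ⟶-All-Ordered l s ps

    col-weaken : ∀ {a b} → a < b → ∀ l → Ordered (col b) l → Ordered (col a) l
    col-weaken a<b (row c) b≤c = ≤-trans (<⇒≤ a<b) b≤c
    col-weaken a<b (col c) p   = ≤-trans (<⇒≤ a<b) ∘ p

    col⇒row : ∀ {b} l → Ordered (col b) l → Ordered (row b) l
    col⇒row (row c) b≤c refl = b≤c
    col⇒row (col c) _        = tt

  -- For the letters after the pair: if `exchange` puts `r` on a row, later rows are above it
  -- because they were already above the col that carried `r`. The new col holds a smaller chip and
  -- inherits the bounds of the old one.
  ⟶-Ordered : ∀ {w w′} → w ⟶ w′ → AllPairs Ordered w → AllPairs Ordered w′
  ⟶-Ordered (pass b<a)     ((_ ∷ p) ∷ q ∷ ps) = (<⇒≤ b<a ∷ q) ∷ p ∷ ps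
  ⟶-Ordered (exchange a<b) (_ ∷ q ∷ ps)       =
    (<⇒≤ a<b ∷ All.map (λ {l} → col-weaken a<b l) q) ∷ All.map (λ {l} → col⇒row l) q ∷ ps
  ⟶-Ordered (l ∷ s)        (p ∷ ps)           = ⟶-All-Ordered l s p ∷ ⟶-Ordered s ps

  ⟶*-Ordered : ∀ {w w′} → w ⟶* w′ → AllPairs Ordered w → AllPairs Ordered w′
  ⟶*-Ordered ε        ps = ps
  ⟶*-Ordered (s ◅ ss) ps = ⟶*-Ordered ss (⟶-Ordered s ps)

  initial-Ordered : ∀ {ρ γ} → r ∉ ρ → r ∉ γ → AllPairs Ordered (map row ρ ++ map col (r ∷ γ))
  initial-Ordered r∉ρ r∉γ = AllPairs.++⁺ (AllPairs.map⁺ (rows _ r∉ρ))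
    (All.map⁺ (All.tabulate λ { y∈ refl → contradiction y∈ r∉γ }) ∷ AllPairs.map⁺ (cols _ r∉γ))
    (All.map⁺ (All.tabulate λ _ → All.map⁺ (All.tabulate λ _ → tt)))
    where
    rows : ∀ ρ → r ∉ ρ → AllPairs (λ a b → a ≡ r → r ≤ b) ρ
    rows []      _  = []
    rows (x ∷ ρ) r∉ = All.tabulate (λ { _ refl → contradiction (here refl) r∉ }) ∷ rows ρ (r∉ ∘ there)
    cols : ∀ γ → r ∉ γ → AllPairs (λ a b → b ≡ r → a ≤ r) γ
    cols []      _  = []
    cols (x ∷ γ) r∉ = All.tabulate (λ { y∈ refl → contradiction (there y∈) r∉ }) ∷ cols γ (r∉ ∘ there)

-- Words and configurations

position : ℕ → Letter → ℕ
position k (col _) = k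
position k (row _) = suc k

data Placed (c : Config) : ℕ → Word → Set where
  []  : ∀ {k} → Placed c k []
  _∷_ : ∀ {k l w} → c (chip l) ≡ + position k l → Placed c (suc k) w → Placed c k (l ∷ w)

private
  variable
    c c′ : Config
    k n : ℕ
    w w′ : Word
    l : Letter

Placed-cong : All (λ x → c′ x ≡ c x) (chips w) → Placed c k w → Placed c′ k w
Placed-cong []         []       = []
Placed-cong (eq ∷ eqs) (p ∷ ps) = trans eq p ∷ Placed-cong eqs ps

Placed-++⁺ : ∀ u {v} → Placed c k u → Placed c (length u + k) v → Placed c k (u ++ v)
Placed-++⁺ []      _        qs = qs
Placed-++⁺ {c} {k} (l ∷ u) {v} (p ∷ ps) qs =
  p ∷ Placed-++⁺ u ps (subst (λ j → Placed c j v) (sym (+-suc (length u) k)) qs)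

Placed-++⁻ : ∀ u {v} → Placed c k (u ++ v) → Placed c k u × Placed c (length u + k) v
Placed-++⁻ []      qs = [] , qs
Placed-++⁻ {c} {k} (l ∷ u) {v} (p ∷ ps) with Placed-++⁻ u ps
... | pu , pv = p ∷ pu , subst (λ j → Placed c j v) (+-suc (length u) k) pv

-- A row at index `k` and a col at index `k + 1` share site `k + 1`. Hence inserting one letter
-- turns the rows behind it into cols without moving a chip.
Placed-row⇒col : ∀ xs → Placed c k (map row xs) → Placed c (suc k) (map col xs)
Placed-row⇒col []       []       = []
Placed-row⇒col (x ∷ xs) (p ∷ ps) = p ∷ Placed-row⇒col xs ps

k≤position : ∀ k l → k ≤ position k l
k≤position k (row _) = n≤1+n k
k≤position k (col _) = ≤-refl

Placed-≥ : Placed c k w → All (λ x → + k ℤ.≤ c x) (chips w)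
Placed-≥ [] = []
Placed-≥ {k = k} (_∷_ {l = l} p ps) =
  ℤ.≤-trans (ℤ.+≤+ (k≤position k l)) (ℤ.≤-reflexive (sym p)) ∷
  All.map (ℤ.≤-trans (ℤ.+≤+ (n≤1+n k))) (Placed-≥ ps)

Placed-> : Placed c (suc k) w → b ∈ chips w → ¬ c b ≡ + k
Placed-> {c = c} {k = k} ps b∈ cb≡k =
  n≮n k (ℤ.drop‿+≤+ (subst (+ suc k ℤ.≤_) cb≡k (All.lookup (Placed-≥ ps) b∈)))

-- The head sits at site `k` or `k + 1`, the next letter at `k + 1` or `k + 2`, and everything
-- further right at `k + 2` or beyond. Only a row followed by a col can meet.
collision : Placed c k (l ∷ w) → b ∈ chips w → c (chip l) ≡ c b →
            ∃₂ λ a v → l ≡ row a × w ≡ col b ∷ v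
collision {l = col _} (p ∷ ps) b∈ eq = contradiction (trans (sym eq) p) (Placed-> ps b∈)
collision {l = row a} {w = row _ ∷ v} (p ∷ q ∷ ps) (here refl) eq
  with () ← n≮n _ (≤-reflexive (+-injective (trans (sym q) (trans (sym eq) p))))
collision {l = row a} {w = col _ ∷ v} (p ∷ q ∷ ps) (here refl) eq = a , v , refl , refl
collision {l = row a} {w = _ ∷ v} (p ∷ q ∷ ps) (there b∈) eq =
  contradiction (trans (sym eq) p) (Placed-> ps b∈)

left-of : ∀ {z} k → z ≡ + suc k → z ℤ.- + 1 ≡ + k
left-of k refl = refl

right-of : ∀ {z} k → z ≡ + suc k → z ℤ.+ + 1 ≡ + suc (suc k)
right-of k refl = cong (+_ ∘ suc) (+-comm k 1)

-- Descend to the first of the two chips; by `collision` the other is on the next letter. The move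
-- is `exchange` if the smaller chip is on the row and `pass` if it is on the col.
topple⇒⟶ : ∀ {α β} → Placed c k w → Unique (chips w) → α < β → c α ≡ c β →
           c′ α ≡ c α ℤ.- + 1 → c′ β ≡ c β ℤ.+ + 1 → (∀ x → x ≢ α → x ≢ β → c′ x ≡ c x) →
           α ∈ chips w → β ∈ chips w → ∃ λ w′ → w ⟶ w′ × Placed c′ k w′
topple⇒⟶ {w = _ ∷ _} _ _ α<β _ _ _ _ (here refl) (here refl) = contradiction refl (<⇒≢ α<β)
topple⇒⟶ {w = l ∷ w} (p ∷ ps) (l∉ ∷ w!) α<β same min max rest (there α∈) (there β∈)
  with topple⇒⟶ ps w! α<β same min max rest α∈ β∈
... | w′ , w⟶w′ , ps′ = l ∷ w′ , l ∷ w⟶w′ ,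
  trans (rest (chip l) (All.lookup l∉ α∈) (All.lookup l∉ β∈)) p ∷ ps′
topple⇒⟶ {k = k} {w = _ ∷ _} ps w! α<β same min max rest (here refl) (there β∈)
  with collision ps β∈ same
topple⇒⟶ {k = k} {w = _ ∷ _} (p ∷ q ∷ ps) ((_ ∷ α∉) ∷ β∉ ∷ _) α<β same min max rest (here refl) (there β∈)
  | _ , _ , refl , refl = _ , exchange α<β ,
  trans min (left-of k p) ∷ trans max (right-of k q) ∷
  Placed-cong (All.tabulate λ x∈ →
    rest _ (All.lookup α∉ x∈ ∘ sym) (All.lookup β∉ x∈ ∘ sym)) ps
topple⇒⟶ {k = k} {w = _ ∷ _} ps w! α<β same min max rest (there α∈) (here refl)
  with collision ps α∈ (sym same)
topple⇒⟶ {k = k} {w = _ ∷ _} (p ∷ q ∷ ps) ((_ ∷ β∉) ∷ α∉ ∷ _) α<β same min max rest (there α∈) (here refl)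
  | _ , _ , refl , refl = _ , pass α<β ,
  trans min (left-of k q) ∷ trans max (right-of k p) ∷
  Placed-cong (All.tabulate λ x∈ →
    rest _ (All.lookup α∉ x∈ ∘ sym) (All.lookup β∉ x∈ ∘ sym)) ps

Step⇒⟶ : Placed c k w → chips w ↭ range1 n → Step n c c′ → ∃ λ w′ → w ⟶ w′ × Placed c′ k w′
Step⇒⟶ {c = c} {w = w} {n = n} {c′ = c′} ps range s =
  topple⇒⟶ ps (↭-range1⇒Unique n range) α<β (trans cα (sym cβ))
    (trans c'α (cong (ℤ._- + 1) (sym cα))) (trans c'β (cong (ℤ._+ + 1) (sym cβ))) rest
    (chip∈ 1≤α (≤-trans (<⇒≤ α<β) β≤n)) (chip∈ (≤-trans 1≤α (<⇒≤ α<β)) β≤n)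
  where
  open Step s
  chip∈ : ∀ {x} → 1 ≤ x → x ≤ n → x ∈ chips w
  chip∈ 1≤x x≤n = ∈-resp-↭ (↭-sym range) (∈-range1⁺ 1≤x x≤n)

Star-Step⇒⟶* : Placed c 0 w → chips w ↭ range1 n → Star (Step n) c c′ →
               ∃ λ w′ → w ⟶* w′ × Placed c′ 0 w′
Star-Step⇒⟶* ps range ε = _ , ε , ps
Star-Step⇒⟶* ps range (s ◅ ss) with Step⇒⟶ ps range s
... | _ , w⟶w′ , ps′ with Star-Step⇒⟶* ps′ (↭-trans (↭-sym (⟶-chips w⟶w′)) range) ss
...   | w″ , w′⟶*w″ , ps″ = w″ , w⟶w′ ◅ w′⟶*w″ , ps″

topple : ℕ → ℕ → Config → Config
topple α β c x with x ≟ α | x ≟ β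
... | yes _ | _     = c α ℤ.- + 1
... | no _  | yes _ = c α ℤ.+ + 1
... | no _  | no _  = c x

topple-min : ∀ α β c → topple α β c α ≡ c α ℤ.- + 1
topple-min α β c with α ≟ α | α ≟ β
... | yes _ | _ = refl
... | no α≢α | _ = contradiction refl α≢α

topple-max : ∀ {α β} c → α < β → topple α β c β ≡ c α ℤ.+ + 1
topple-max {α} {β} c α<β with β ≟ α | β ≟ β
... | yes refl | _      = contradiction α<β (n≮n _)
... | no _     | yes _  = refl
... | no _     | no β≢β = contradiction refl β≢β

topple-rest : ∀ {α β} c x → x ≢ α → x ≢ β → topple α β c x ≡ c x
topple-rest {α} {β} c x x≢α x≢β with x ≟ α | x ≟ β
... | yes x≡α | _       = contradiction x≡α x≢α
... | no _    | yes x≡β = contradiction x≡β x≢β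
... | no _    | no _    = refl

topple-Step : ∀ {α β} → 1 ≤ α → α < β → β ≤ n → c α ≡ c β → Step n c (topple α β c)
topple-Step {c = c} {α} {β} 1≤α α<β β≤n same = record
  { 1≤α = 1≤α ; α<β = α<β ; β≤n = β≤n
  ; cα = refl ; cβ = sym same
  ; c'α = topple-min α β c ; c'β = topple-max c α<β
  ; rest = topple-rest c
  }

-- The last component keeps a front letter placed when the move happens deeper in the word. An
-- inclusion in `range1 n`, unlike a permutation, passes to tails.
⟶⇒Step : Placed c k w → Unique (chips w) → chips w ⊆ range1 n → w ⟶ w′ →
         ∃ λ c′ → Step n c c′ × Placed c′ k w′ × (∀ x → x ∉ chips w → c′ x ≡ c x)
⟶⇒Step {c} {k} {n = n} (p ∷ q ∷ ps) ((_ ∷ a∉) ∷ b∉ ∷ _) ⊆range (pass b<a) =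
  _ , topple-Step (proj₁ (∈-range1⁻ {n} (⊆range (there (here refl))))) b<a
        (proj₂ (∈-range1⁻ {n} (⊆range (here refl)))) (trans q (sym p)) ,
  trans (topple-min _ _ c) (left-of k q) ∷
  trans (topple-max c b<a) (right-of k q) ∷
  Placed-cong (All.tabulate λ x∈ →
    topple-rest c _ (All.lookup b∉ x∈ ∘ sym) (All.lookup a∉ x∈ ∘ sym)) ps ,
  λ x x∉ → topple-rest c x (λ { refl → x∉ (there (here refl)) }) (λ { refl → x∉ (here refl) })
⟶⇒Step {c} {k} {n = n} (p ∷ q ∷ ps) ((_ ∷ a∉) ∷ b∉ ∷ _) ⊆range (exchange a<b) =
  _ , topple-Step (proj₁ (∈-range1⁻ {n} (⊆range (here refl)))) a<b
        (proj₂ (∈-range1⁻ {n} (⊆range (there (here refl))))) (trans p (sym q)) ,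
  trans (topple-min _ _ c) (left-of k p) ∷
  trans (topple-max c a<b) (right-of k p) ∷
  Placed-cong (All.tabulate λ x∈ →
    topple-rest c _ (All.lookup a∉ x∈ ∘ sym) (All.lookup b∉ x∈ ∘ sym)) ps ,
  λ x x∉ → topple-rest c x (λ { refl → x∉ (here refl) }) (λ { refl → x∉ (there (here refl)) })
⟶⇒Step (p ∷ ps) w!@(_ ∷ v!) ⊆range (l ∷ s) with ⟶⇒Step ps v! (⊆range ∘ there) s
... | c′ , step , ps′ , rest =
  c′ , step , trans (rest (chip l) (Unique[x∷xs]⇒x∉xs w!)) p ∷ ps′ , λ x x∉ → rest x (x∉ ∘ there)

⟶*⇒Star-Step : Placed c 0 w → chips w ↭ range1 n → w ⟶* w′ →
               ∃ λ c′ → Star (Step n) c c′ × Placed c′ 0 w′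
⟶*⇒Star-Step ps _ ε = _ , ε , ps
⟶*⇒Star-Step {n = n} ps range (s ◅ ss)
  with ⟶⇒Step {n = n} ps (↭-range1⇒Unique n range) (∈-resp-↭ range) s
... | _ , step , ps′ , _ with ⟶*⇒Star-Step ps′ (↭-trans (↭-sym (⟶-chips s)) range) ss
...   | c″ , steps , ps″ = c″ , step ◅ steps , ps″

-- Initial and final words

configOf-here : ∀ x s ps → configOf ((x , s) ∷ ps) x ≡ + s
configOf-here x s ps with x ≟ x
... | yes _  = refl
... | no x≢x = contradiction refl x≢x

configOf-there : ∀ {x y s} ps → y ≢ x → configOf ((x , s) ∷ ps) y ≡ configOf ps y
configOf-there {x} {y} ps y≢x with y ≟ x
... | yes y≡x = contradiction y≡x y≢x
... | no _    = refl

-- The site function is general because `applyUpTo` recurses with `f ∘ suc`, which matches raising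
-- `k`.
zip-Placed : ∀ k f ys → Unique ys → (∀ i → f i ≡ suc (i + k)) →
             Placed (configOf (zip ys (applyUpTo f (length ys)))) k (map row ys)
zip-Placed k f []       _         _  = []
zip-Placed k f (y ∷ ys) (y∉ ∷ ys!) eq =
  trans (configOf-here y (f 0) _) (cong +_ (eq 0)) ∷
  Placed-cong
    (subst (All _) (sym (chips-rows ys)) (All.map (λ y≢x → configOf-there _ (y≢x ∘ sym)) y∉))
    (zip-Placed (suc k) (f ∘ suc) ys ys! (λ i → trans (eq (suc i)) (cong suc (sym (+-suc i k)))))

-- Without `r`, the chips on sites 1, 2, ... form a word of rows. A col inserted at index `length ρ`
-- sits at that very site, and the rows behind it become cols.
placement-Placed : ∀ ρ γ {r} → Unique (r ∷ ρ ++ γ) →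
                   Placed (placement r (ρ ++ γ) (length ρ)) 0 (map row ρ ++ map col (r ∷ γ))
placement-Placed ρ γ {r} (r∉ ∷ rest!) = Placed-++⁺ (map row ρ) (proj₁ split)
  (trans (configOf-here r (length ρ) _)
     (cong +_ (sym (trans (+-identityʳ _) (length-map row ρ))))
   ∷ Placed-row⇒col γ (proj₂ split))
  where
  rows : Placed (placement r (ρ ++ γ) (length ρ)) 0 (map row (ρ ++ γ))
  rows = Placed-cong
    (subst (All _) (sym (chips-rows (ρ ++ γ)))
      (All.map (λ r≢x → trans (configOf-there _ (r≢x ∘ sym))
        (cong (λ sites → configOf (zip (ρ ++ γ) sites) _) (map-upTo suc _))) r∉))
    (zip-Placed 0 suc (ρ ++ γ) rest! (λ i → cong suc (sym (+-identityʳ i))))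
  split = Placed-++⁻ (map row ρ) (subst (Placed _ 0) (map-++ row ρ γ) rows)

Placed-head-< : ∀ {a} → c a ≡ + k → Placed c (suc k) w → All (λ x → c a ℤ.< c x) (chips w)
Placed-head-< p ps =
  All.map (ℤ.<-≤-trans (ℤ.≤-<-trans (ℤ.≤-reflexive p) (ℤ.+<+ (n<1+n _)))) (Placed-≥ ps)

cols-sorted : ∀ xs → Placed c k (map col xs) → AllPairs (λ a b → c a ℤ.< c b) xs
cols-sorted []       []       = []
cols-sorted (x ∷ xs) (p ∷ ps) =
  subst (All _) (chips-cols xs) (Placed-head-< p ps) ∷ cols-sorted xs ps

final-sorted : ∀ cs xs → Placed c k (map col cs ++ map row xs) →
               AllPairs (λ a b → c a ℤ.< c b) (cs ++ xs)
final-sorted []       xs ps       = cols-sorted xs (Placed-row⇒col xs ps)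
final-sorted (a ∷ cs) xs (p ∷ ps) =
  subst (All _) (chips-cols-rows cs xs) (Placed-head-< p ps) ∷ final-sorted cs xs ps

-- Induction from the right: a row put in front of a word starting with a col would share the site
-- of that col.
Stable⇒final : Placed c k w → Unique (chips w) →
               (∀ {a b} → a ∈ chips w → b ∈ chips w → a ≢ b → c a ≢ c b) →
               ∃₂ λ cs xs → w ≡ map col cs ++ map row xs
Stable⇒final {w = []} _ _ _ = [] , [] , refl
Stable⇒final {w = l ∷ w} (p ∷ ps) (l∉ ∷ w!) stable
  with Stable⇒final ps w! (λ a∈ b∈ → stable (there a∈) (there b∈))
Stable⇒final {w = col a ∷ w} _ _ _ | cs , xs , refl = a ∷ cs , xs , refl
Stable⇒final {w = row a ∷ w} _ _ _ | [] , xs , refl = [] , a ∷ xs , refl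
Stable⇒final {w = row a ∷ w} (p ∷ q ∷ _) ((a≢b ∷ _) ∷ _) stable | _ ∷ _ , _ , refl =
  contradiction (trans p (sym q)) (stable (here refl) (there (here refl)) a≢b)

-- The result of toppling

record Outcome (n p r : ℕ) (π : List ℕ) : Set where
  field
    low high : List ℕ
    π≡       : π ≡ low ++ high
    length≡  : length low ≡ n ∸ p
    ordered  : AllPairs (Ordered r) (map col low ++ map row high)

ReadsAs⇒sorted : ∀ π → ReadsAs c π → AllPairs (λ a b → c a ℤ.< c b) π
ReadsAs⇒sorted {c} π reads = subst (AllPairs _) (tabulate-lookup π)
  (AllPairs.tabulate⁺-< λ {i} {j} → reads i j)

TopplesTo⇒Outcome : ∀ {m p r rest π} → p ≤ m → r ∷ rest ↭ range1 (suc m) → π ↭ range1 (suc m) →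
                    (∀ x → c x ≡ placement r rest p x) → TopplesTo (suc m) c π →
                    Outcome (suc m) p r π
TopplesTo⇒Outcome {c} {m} {p} {r} {rest} {π} p≤m start π-range c≗ (c′ , steps , stable , reads) =
  outcome (Star-Step⇒⟶* placed range steps)
  where
  open ≡-Reasoning
  ρ γ : List ℕ
  ρ = take p rest
  γ = drop p rest
  word : Word
  word = map row ρ ++ map col (r ∷ γ)
  chips! : Unique (r ∷ rest)
  chips! = ↭-range1⇒Unique (suc m) start
  split : ρ ++ γ ≡ rest
  split = take++drop≡id p rest
  length-rest : length rest ≡ m
  length-rest = suc-injective (trans (↭-length start) (length-range1 (suc m)))
  length-ρ : length ρ ≡ p
  length-ρ = trans (length-take p rest) (m≤n⇒m⊓n≡m (≤-trans p≤m (≤-reflexive (sym length-rest))))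
  placed : Placed c 0 word
  placed = Placed-cong (All.tabulate λ {x} _ → c≗ x)
    (subst₂ (λ q s → Placed (placement r s q) 0 word) length-ρ split
      (placement-Placed ρ γ (subst (Unique ∘ (r ∷_)) (sym split) chips!)))
  range : chips word ↭ range1 (suc m)
  range = ↭-trans (↭-reflexive (chips-rows-cols ρ (r ∷ γ))) (↭-trans (shift r ρ γ)
    (↭-trans (↭-reflexive (cong (r ∷_) split)) start))
  r∉ : r ∉ ρ ++ γ
  r∉ r∈ = Unique[x∷xs]⇒x∉xs chips! (subst (r ∈_) split r∈)
  outcome : (∃ λ w → word ⟶* w × Placed c′ 0 w) → Outcome (suc m) p r π
  outcome (w , word⟶*w , placed′)
    with range′ ← ↭-trans (↭-sym (⟶*-chips word⟶*w)) range
    with Stable⇒final placed′ (↭-range1⇒Unique (suc m) range′) (λ a∈ b∈ →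
      let 1≤a , a≤n = ∈-range1⁻ {suc m} (∈-resp-↭ range′ a∈)
          1≤b , b≤n = ∈-range1⁻ {suc m} (∈-resp-↭ range′ b∈)
      in stable _ _ 1≤a a≤n 1≤b b≤n)
  ... | cs , xs , refl = record
    { low     = cs
    ; high    = xs
    -- Both lists are sorted by their sites in `c′` and hold the same chips.
    ; π≡      = sorted-↭⇒≡ ℤ.<-asym (ReadsAs⇒sorted π reads) (final-sorted cs xs placed′)
                  (↭-trans π-range (↭-trans (↭-sym range′) (↭-reflexive (chips-cols-rows cs xs))))
    ; length≡ = begin
        length cs                             ≡⟨ sym (columns-cols-rows cs xs) ⟩
        columns (map col cs ++ map row xs)    ≡⟨ sym (⟶*-columns word⟶*w) ⟩
        columns word                          ≡⟨ columns-rows-cols ρ (r ∷ γ) ⟩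
        suc (length γ)                        ≡⟨ cong suc (length-drop p rest) ⟩
        suc (length rest ∸ p)                 ≡⟨ cong (λ k → suc (k ∸ p)) length-rest ⟩
        suc (m ∸ p)                           ≡⟨ sym (+-∸-assoc 1 p≤m) ⟩
        suc m ∸ p                             ∎
    ; ordered = ⟶*-Ordered r word⟶*w
                  (initial-Ordered r (r∉ ∘ ∈-++⁺ˡ) (r∉ ∘ ∈-++⁺ʳ ρ))
    }

-- The col-before-row clause of `Ordered` does not mention `r`, so the bound can be drawn from an
-- outcome with any extra chip.
Ordered⇒low<high : ∀ {r} cs {xs} → Unique (cs ++ xs) →
                   AllPairs (Ordered r) (map col cs ++ map row xs) →
                   All (λ a → All (a <_) xs) cs
Ordered⇒low<high cs {xs} chips! ordered = All.zipWith
  (λ (≤xs , ≢xs) → All.zipWith (λ (a≤b , a≢b) → ≤∧≢⇒< a≤b a≢b) (All.map⁻ ≤xs , ≢xs))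
  (All.map⁻ (proj₂ (proj₂ (AllPairs-++⁻ (map col cs) ordered))) ,
   proj₂ (proj₂ (AllPairs-++⁻ cs chips!)))

Ordered⇒LRMax : ∀ {r cs} → AllPairs (Ordered r) (map col cs) → r ∈ cs → LRMax r cs
Ordered⇒LRMax ordered r∈ with ∈-∃++ r∈
... | us , vs , refl = LRMax⁺ us (All.map (λ r≥ → All.head r≥ refl)
  (proj₂ (proj₂ (AllPairs-++⁻ us (AllPairs.map⁻ ordered)))))

Ordered⇒RLMin : ∀ {r xs} → Unique xs → AllPairs (Ordered r) (map row xs) → r ∈ xs → RLMin r xs
Ordered⇒RLMin xs! ordered r∈ with ∈-∃++ r∈
... | us , vs , refl
  with r≤ ∷ _ ← proj₁ (proj₂ (AllPairs-++⁻ us (AllPairs.map⁻ ordered)))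
     | r≢ ∷ _ ← proj₁ (proj₂ (AllPairs-++⁻ us xs!))
  = RLMin⁺ us (All.zipWith (λ (r≤b , r≢b) → ≤∧≢⇒< (r≤b refl) r≢b) (r≤ , r≢))

-- Words with prescribed results

in-context : ∀ u → w ⟶* w′ → u ++ w ⟶* u ++ w′
in-context []      ss = ss
in-context (l ∷ u) ss = gmap (l ∷_) (l ∷_) (in-context u ss)

col-passes : ∀ {ρ b v} → All (b <_) ρ → map row ρ ++ col b ∷ v ⟶* col b ∷ map row ρ ++ v
col-passes []           = ε
col-passes (b<a ∷ b<ρ) = in-context [ row _ ] (col-passes b<ρ) ◅◅ (pass b<a ◅ ε)

-- The leftmost col goes first: once it has passed all rows, they stand directly before the next
-- col.
cols-pass : ∀ {ρ γ v} → All (λ b → All (b <_) ρ) γ →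
            map row ρ ++ map col γ ++ v ⟶* map col γ ++ map row ρ ++ v
cols-pass []           = ε
cols-pass (b<ρ ∷ γ<ρ) = col-passes b<ρ ◅◅ in-context [ col _ ] (cols-pass γ<ρ)

low-head-⟶* : ∀ {r cs xs} → All (λ b → All (b <_) xs) (r ∷ cs) →
              map row xs ++ map col (r ∷ cs) ⟶* map col (r ∷ cs) ++ map row xs
low-head-⟶* {r} {cs} {xs} cs<xs =
  subst₂ _⟶*_ (cong (map row xs ++_) (++-identityʳ _)) (cong (map col (r ∷ cs) ++_) (++-identityʳ _))
    (cols-pass cs<xs)

-- Row `s` meets col `r` first; since `s` is smaller, `r` becomes a row. The cols `us` pass it, and
-- at col `z`, which is larger, `r` becomes a col again, now in its final place, while `z` becomes
-- the last row.
low-tail-⟶* : ∀ {r s us vs xs z} → All (_< r) (s ∷ us) →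
              All (λ b → All (b <_) (xs ∷ʳ z)) (s ∷ us ++ r ∷ vs) →
              map row (xs ∷ʳ s) ++ map col (r ∷ us ++ z ∷ vs) ⟶*
              map col (s ∷ us ++ r ∷ vs) ++ map row (xs ∷ʳ z)
low-tail-⟶* {r} {s} {us} {vs} {xs} {z} (s<r ∷ us<r) low<high =
  subst₂ _⟶*_ start end
    (in-context (map row xs) (exchange s<r ◅ in-context [ col s ]
      (cols-pass {ρ = [ r ]} (All.map (_∷ []) us<r)
       ◅◅ in-context (map col us) (exchange r<z ◅ ε)))
     -- From here on only `pass` occurs: first `γ` crosses the rows `xs`, then `vs` crosses `xs` and
     -- `z`.
     ◅◅ subst₂ _⟶*_ middle (cong (map col γ ++_) (sym row-z)) (cols-pass γ<xs)
     ◅◅ in-context (map col γ) (subst₂ _⟶*_ (cong (map row (xs ∷ʳ z) ++_) (++-identityʳ _))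
          (cong (map col vs ++_) (++-identityʳ _)) (cols-pass vs<high)))
  where
  γ : List ℕ
  γ = s ∷ us ∷ʳ r
  split : γ ++ vs ≡ s ∷ us ++ r ∷ vs
  split = ++-assoc (s ∷ us) [ r ] vs
  low<high′ : All (λ b → All (b <_) (xs ∷ʳ z)) (γ ++ vs)
  low<high′ = subst (All _) (sym split) low<high
  γ<xs : All (λ b → All (b <_) xs) γ
  γ<xs = All.map (All.++⁻ˡ xs) (All.++⁻ˡ γ low<high′)
  vs<high : All (λ b → All (b <_) (xs ∷ʳ z)) vs
  vs<high = All.++⁻ʳ γ low<high′
  r<z : r < z
  r<z = All.head (All.++⁻ʳ xs (All.head (All.++⁻ʳ (s ∷ us) low<high)))
  row-z : ∀ {v} → map row (xs ∷ʳ z) ++ v ≡ map row xs ++ row z ∷ v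
  row-z {v} = trans (cong (_++ v) (map-++ row xs [ z ])) (++-assoc (map row xs) [ row z ] v)
  start : map row xs ++ row s ∷ col r ∷ map col us ++ col z ∷ map col vs ≡
          map row (xs ∷ʳ s) ++ map col (r ∷ us ++ z ∷ vs)
  start = sym (trans (cong (_++ map col (r ∷ us ++ z ∷ vs)) (map-++ row xs [ s ]))
    (trans (++-assoc (map row xs) [ row s ] _)
      (cong (λ v → map row xs ++ row s ∷ col r ∷ v) (map-++ col us (z ∷ vs)))))
  middle : map row xs ++ map col γ ++ row z ∷ map col vs ≡
           map row xs ++ col s ∷ map col us ++ col r ∷ row z ∷ map col vs
  middle = cong (map row xs ++_) (trans (cong (_++ row z ∷ map col vs) (map-++ col (s ∷ us) [ r ]))
    (++-assoc (map col (s ∷ us)) [ col r ] _))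
  end : map col γ ++ map col vs ++ map row (xs ∷ʳ z) ≡
        map col (s ∷ us ++ r ∷ vs) ++ map row (xs ∷ʳ z)
  end = trans (sym (++-assoc (map col γ) (map col vs) _))
    (cong (_++ map row (xs ∷ʳ z)) (trans (sym (map-++ col γ vs)) (cong (map col) split)))

-- Col `r` passes the larger rows `vs` and meets row `s`. The exchange leaves `r` as a row in its
-- final place, and col `s` goes on past `us`; the cols `cs` then pass every row.
high-⟶* : ∀ {r s cs us vs} → All (r <_) vs → All (λ b → All (b <_) (us ++ r ∷ vs)) (s ∷ cs) →
          map row (us ++ s ∷ vs) ++ map col (r ∷ cs) ⟶*
          map col (s ∷ cs) ++ map row (us ++ r ∷ vs)
high-⟶* {r} {s} {cs} {us} {vs} r<vs (s<high ∷ cs<high) =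
  subst₂ _⟶*_ (sym (rows s)) (cong (λ v → col s ∷ map col cs ++ v) (++-identityʳ _))
    (in-context (map row us) (in-context [ row s ] (col-passes r<vs) ◅◅ (exchange s<r ◅ ε))
     ◅◅ col-passes (All.++⁻ˡ us s<high)
     ◅◅ in-context [ col s ] (subst₂ _⟶*_
          (trans (cong (map row (us ++ r ∷ vs) ++_) (++-identityʳ _)) (rows r)) refl
          (cols-pass cs<high)))
  where
  s<r : s < r
  s<r = All.head (All.++⁻ʳ us s<high)
  rows : ∀ x {v} → map row (us ++ x ∷ vs) ++ v ≡ map row us ++ row x ∷ map row vs ++ v
  rows x {v} = trans (cong (_++ v) (map-++ row us (x ∷ vs))) (++-assoc (map row us) _ v)

⟶*⇒TopplesTo : ∀ {m r} ρ {γ cs xs} → 1 ≤ r → r ≤ suc m → cs ++ xs ↭ range1 (suc m) →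
               map row ρ ++ map col (r ∷ γ) ⟶* map col cs ++ map row xs →
               ∃ λ σ → σ ↭ range1 m × TopplesTo (suc m) (sigmaConfig σ r (length ρ)) (cs ++ xs)
⟶*⇒TopplesTo {m} {r} ρ {γ} {cs} {xs} 1≤r r≤n π-range derivation =
  -- Cancelling `r` shows that the other chips rearrange the relabelled 1 to `m`; undoing the
  -- relabelling yields `σ`.
  result (↭-map-inv (relabel r) (drop-∷ (↭-trans (relabel-range1 m 1≤r r≤n) (↭-sym start))))
  where
  range : chips (map row ρ ++ map col (r ∷ γ)) ↭ range1 (suc m)
  range = ↭-trans (⟶*-chips derivation) (↭-trans (↭-reflexive (chips-cols-rows cs xs)) π-range)
  start : r ∷ ρ ++ γ ↭ range1 (suc m)
  start = ↭-trans (↭-sym (shift r ρ γ))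
    (↭-trans (↭-reflexive (sym (chips-rows-cols ρ (r ∷ γ)))) range)
  topples : (∃ λ c′ → Star (Step (suc m)) c c′ × Placed c′ 0 (map col cs ++ map row xs)) →
            TopplesTo (suc m) c (cs ++ xs)
  topples (c′ , steps , placed) = c′ , steps , stable , λ _ _ → AllPairs-lookup sorted
    where
    sorted : AllPairs (λ a b → c′ a ℤ.< c′ b) (cs ++ xs)
    sorted = final-sorted cs xs placed
    chip∈ : ∀ {x} → 1 ≤ x → x ≤ suc m → x ∈ cs ++ xs
    chip∈ 1≤x x≤n = ∈-resp-↭ (↭-sym π-range) (∈-range1⁺ 1≤x x≤n)
    stable : Stable (suc m) c′
    stable a b 1≤a a≤n 1≤b b≤n a≢b
      with AllPairs-compare sorted (chip∈ 1≤a a≤n) (chip∈ 1≤b b≤n) a≢b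
    ... | inj₁ a<b = ℤ.<⇒≢ a<b
    ... | inj₂ b<a = ℤ.<⇒≢ b<a ∘ sym
  result : (∃ λ σ → ρ ++ γ ≡ map (relabel r) σ × range1 m ↭ σ) →
           ∃ λ σ → σ ↭ range1 m × TopplesTo (suc m) (sigmaConfig σ r (length ρ)) (cs ++ xs)
  result (σ , eq , range1↭σ) = σ , ↭-sym range1↭σ ,
    subst (λ rest → TopplesTo (suc m) (placement r rest (length ρ)) (cs ++ xs)) eq
      (topples (⟶*⇒Star-Step
        (placement-Placed ρ γ (↭-range1⇒Unique (suc m) start)) range derivation))

-- The two directions of the criterion.

topples⇒record : ∀ {m p r cs xs} → p ≤ m → 1 ≤ r → r ≤ suc m → cs ++ xs ↭ range1 (suc m) →
                 length cs ≡ suc m ∸ p →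
                 (∃ λ σ → σ ↭ range1 m × TopplesTo (suc m) (sigmaConfig σ r p) (cs ++ xs)) →
                 (r ≤ length cs → LRMax r cs) × (length cs < r → RLMin r xs)
topples⇒record {m} {p} {r} {cs} {xs} p≤m 1≤r r≤n π-range length-cs (σ , σ-range , topples) =
  conclude (TopplesTo⇒Outcome p≤m
    (↭-trans (prep r (map⁺ (relabel r) σ-range)) (relabel-range1 m 1≤r r≤n))
    π-range (λ _ → refl) topples)
  where
  conclude : Outcome (suc m) p r (cs ++ xs) →
             (r ≤ length cs → LRMax r cs) × (length cs < r → RLMin r xs)
  conclude record { low = low ; π≡ = π≡ ; length≡ = length≡ ; ordered = ordered }
    -- Both splits cut the same list after `suc m ∸ p` chips.
    with refl , refl ← ++-injective {us = low} {cs} (sym π≡) (trans length≡ (sym length-cs))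
    = lrmax , rlmin
    where
    chips! : Unique (cs ++ xs)
    chips! = ↭-range1⇒Unique (suc m) π-range
    cs<xs : All (λ a → All (a <_) xs) cs
    cs<xs = Ordered⇒low<high cs chips! ordered
    r∈ : r ∈ cs ⊎ r ∈ xs
    r∈ = ∈-++⁻ cs (∈-resp-↭ (↭-sym π-range) (∈-range1⁺ 1≤r r≤n))
    lrmax : r ≤ length cs → LRMax r cs
    lrmax r≤ with r∈
    ... | inj₁ r∈cs = Ordered⇒LRMax (proj₁ (AllPairs-++⁻ (map col cs) ordered)) r∈cs
    ... | inj₂ r∈xs = contradiction (∈-high⇒> π-range cs<xs r∈xs) (≤⇒≯ r≤)
    rlmin : length cs < r → RLMin r xs
    rlmin r> with r∈
    ... | inj₁ r∈cs = contradiction (∈-low⇒≤ π-range cs<xs r∈cs) (<⇒≱ r>)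
    ... | inj₂ r∈xs = Ordered⇒RLMin (proj₁ (proj₂ (AllPairs-++⁻ cs chips!)))
      (proj₁ (proj₂ (AllPairs-++⁻ (map col cs) ordered))) r∈xs

record⇒topples : ∀ {m r cs xs} → 1 ≤ r → r ≤ suc m → cs ++ xs ↭ range1 (suc m) →
                 All (λ a → All (a <_) xs) cs → 1 ≤ length cs → 1 ≤ length xs →
                 LRMax r cs ⊎ RLMin r xs →
                 ∃ λ σ → σ ↭ range1 m × TopplesTo (suc m) (sigmaConfig σ r (length xs)) (cs ++ xs)
record⇒topples {m} {r} {cs} {xs} 1≤r r≤n π-range cs<xs 1≤cs 1≤xs (inj₁ lrmax)
  with LRMax⁻ cs lrmax
... | [] , vs , refl , _ = ⟶*⇒TopplesTo xs {cs = r ∷ vs} {xs} 1≤r r≤n π-range (low-head-⟶* cs<xs)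
... | s ∷ us , vs , refl , us≤r with initLast xs
-- The empty case is excluded by `1≤xs`; the last row supplies the third chip `z` of the rotation.
...   | xs′ ∷ʳ′ z = subst
  (λ p → ∃ λ σ → σ ↭ range1 m × TopplesTo (suc m) (sigmaConfig σ r p) (cs ++ xs′ ∷ʳ z))
  (trans (length-++ xs′) (sym (length-++ xs′)))
  (⟶*⇒TopplesTo (xs′ ∷ʳ s) {cs = cs} {xs′ ∷ʳ z} 1≤r r≤n π-range (low-tail-⟶* us<r cs<xs))
  where
  cs! : Unique (s ∷ us ++ r ∷ vs)
  cs! = proj₁ (AllPairs-++⁻ cs (↭-range1⇒Unique (suc m) π-range))
  us<r : All (_< r) (s ∷ us)
  us<r = All.zipWith (λ (u≤r , u≢) → ≤∧≢⇒< u≤r (All.head u≢))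
    (us≤r , proj₂ (proj₂ (AllPairs-++⁻ (s ∷ us) cs!)))
record⇒topples {m} {r} {s ∷ cs} {xs} 1≤r r≤n π-range cs<xs 1≤cs 1≤xs (inj₂ rlmin)
  with RLMin⁻ xs rlmin
... | us , vs , refl , r<vs = subst
  (λ p → ∃ λ σ → σ ↭ range1 m × TopplesTo (suc m) (sigmaConfig σ r p) (s ∷ cs ++ us ++ r ∷ vs))
  (trans (length-++ us) (sym (length-++ us)))
  (⟶*⇒TopplesTo (us ++ s ∷ vs) {cs = s ∷ cs} {xs} 1≤r r≤n π-range (high-⟶* r<vs cs<xs))

theorem2p13 : ∀ (n p r : ℕ) (π : List ℕ) →
    2 ≤ n → 1 ≤ p → p ≤ n ∸ 1 → 1 ≤ r → r ≤ n →
    π ↭ range1 n → Resultant n p π →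
    ((∃ λ (σ : List ℕ) → (σ ↭ range1 (n ∸ 1)) × TopplesTo n (sigmaConfig σ r p) π)
    ⇔ ((r ≤ n ∸ p → LRMax r (take (n ∸ p) π))
    × (n ∸ p < r → RLMin r (drop (n ∸ p) π))))
theorem2p13 (suc m) p r π _ 1≤p p≤m 1≤r r≤n π-range (_ , (_ , _ , start , c≗) , topples)
  -- The witness of resultance has an extra chip of its own. Its outcome gives the split of `π` and,
  -- below, `cs<xs`.
  with TopplesTo⇒Outcome p≤m start π-range c≗ topples
... | record { low = cs ; high = xs ; π≡ = refl ; length≡ = length≡ ; ordered = ordered }
  -- Now `suc m ∸ p` reads `length cs`, and `take` and `drop` give `cs` and `xs`.
  rewrite sym length≡ | take-++ cs {xs} | drop-++ cs {xs} =
  mk⇔ (topples⇒record {cs = cs} {xs} p≤m 1≤r r≤n π-range length≡) converse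
  where
  length-xs : length xs ≡ p
  length-xs = length-≡⇒++-length cs (trans (↭-length π-range) (length-range1 (suc m)))
    (m≤n⇒m≤1+n p≤m) length≡
  1≤cs : 1 ≤ length cs
  1≤cs = subst (1 ≤_) (sym length≡) (m<n⇒0<n∸m (s≤s p≤m))
  1≤xs : 1 ≤ length xs
  1≤xs = subst (1 ≤_) (sym length-xs) 1≤p
  cs<xs : All (λ a → All (a <_) xs) cs
  cs<xs = Ordered⇒low<high cs (↭-range1⇒Unique (suc m) π-range) ordered
  converse : (r ≤ length cs → LRMax r cs) × (length cs < r → RLMin r xs) →
             ∃ λ σ → σ ↭ range1 m × TopplesTo (suc m) (sigmaConfig σ r p) (cs ++ xs)
  converse (lrmax , rlmin) = subst
    (λ p → ∃ λ σ → σ ↭ range1 m × TopplesTo (suc m) (sigmaConfig σ r p) (cs ++ xs)) length-xs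
    (record⇒topples {cs = cs} {xs} 1≤r r≤n π-range cs<xs 1≤cs 1≤xs is-record)
    where
    is-record : LRMax r cs ⊎ RLMin r xs
    is-record with r ≤? length cs
    ... | yes r≤ = inj₁ (lrmax r≤)
    ... | no r≰  = inj₂ (rlmin (≰⇒> r≰))
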